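{- Let $\Gamma=\langle M;R\rangle$ be a graph and let $P\subseteq M$ be a nonempty property. Then the following conditions are equivalent: (1) $P$ is totally preserved under the formula $R(x,y)\vee R(y,x)$; (2) $P$ is totally preserved under the formula $\psi_n(x,y)\vee\psi_n(y,x)$ with some/any $n\geq 1$ (that is, the version of this condition with "for some $n\ge 1$" and the version with "for every $n\ge 1$" are both equivalent to (1) and (3)); (3) $P$ is a union of connected components of $\Gamma$.
   Context: A graph $\Gamma=\langle M;R\rangle$ is a set $M$ with a binary relation $R$ (possibly directed). For $n\in\omega$, $\varphi_n(x,y)$ is the formula saying that there exists an $(x,y)$-path of length $n$ along $R$, and $\psi_n(x,y):=\bigvee_{m\leq n}\varphi_m(x,y)$ says that there exists an $(x,y)$-path of length $\leq n$. A set $P$ is totally preserved under a formula $\theta(x,y)$ if for every $a\in P$, $\theta(a,\Gamma)=\{b\in M\mid\Gamma\models\theta(a,b)\}\subseteq P$. Connected components are those of the graph obtained by forgetting directions, i.e. with edge relation $R(x,y)\vee R(y,x)$. -}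

module Defs where

open import Data.Empty.Polymorphic using (⊥)
open import Data.Fin using (Fin; zero; suc)
open import Data.Nat using (ℕ; zero; suc)
open import Data.Product using (Σ; ∃; _×_)
open import Data.Sum using (_⊎_)
open import Data.Vec using (Vec; []; _∷_; lookup)
open import Level using (Level)
open import Relation.Binary.Construct.Closure.Equivalence using (EqClosure)
open import Relation.Binary.Core using (Rel)
open import Relation.Binary.PropositionalEquality using (_≡_)
open import Relation.Unary using (Pred; _∈_; _⊆_; _≐_; ⋃)

record Graph (ℓ : Level) : Set (Level.suc ℓ) where
  field
    M : Set ℓ
    R : Rel M ℓ

infix  8 _≈ᶠ_
infixr 7 _∧ᶠ_
infixr 6 _∨ᶠ_
infixr 5 _⇒ᶠ_

-- First-order formulas in the language {R} with equality.  The free variables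
-- of a `Formula k` are de Bruijn indices in `Fin k`; a quantifier binds `zero`.
data Formula : ℕ → Set where
  Rᶠ   : ∀ {k} → Fin k → Fin k → Formula k
  _≈ᶠ_ : ∀ {k} → Fin k → Fin k → Formula k
  ⊥ᶠ   : ∀ {k} → Formula k
  _∧ᶠ_ : ∀ {k} → Formula k → Formula k → Formula k
  _∨ᶠ_ : ∀ {k} → Formula k → Formula k → Formula k
  _⇒ᶠ_ : ∀ {k} → Formula k → Formula k → Formula k
  ∃ᶠ   : ∀ {k} → Formula (suc k) → Formula k
  ∀ᶠ   : ∀ {k} → Formula (suc k) → Formula k

-- φ n x y = ∃z₁ (R(x,z₁) ∧ ∃z₂ (R(z₁,z₂) ∧ … ∧ zₙ = y)): a path of length n is a
-- sequence of n consecutive R-edges, in which vertices may repeat; the path of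
-- length 0 joins x to itself.
φ : ∀ {k} → ℕ → Fin k → Fin k → Formula k
φ zero    x y = x ≈ᶠ y
φ (suc n) x y = ∃ᶠ (Rᶠ (suc x) zero ∧ᶠ φ n zero (suc y))

ψ : ∀ {k} → ℕ → Fin k → Fin k → Formula k
ψ zero    x y = φ zero x y
ψ (suc n) x y = ψ n x y ∨ᶠ φ (suc n) x y

-- The two free variables of a `Formula 2`.
𝐱 𝐲 : Fin 2
𝐱 = zero
𝐲 = suc zero

module _ {ℓ : Level} (Γ : Graph ℓ) where
  open Graph Γ

  Sat : ∀ {k} → Vec M k → Formula k → Set ℓ
  Sat ρ (Rᶠ i j)  = R (lookup ρ i) (lookup ρ j)
  Sat ρ (i ≈ᶠ j)  = lookup ρ i ≡ lookup ρ j
  Sat ρ ⊥ᶠ        = ⊥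
  Sat ρ (α ∧ᶠ β)  = Sat ρ α × Sat ρ β
  Sat ρ (α ∨ᶠ β)  = Sat ρ α ⊎ Sat ρ β
  Sat ρ (α ⇒ᶠ β)  = Sat ρ α → Sat ρ β
  Sat ρ (∃ᶠ α)    = ∃ λ (c : M) → Sat (c ∷ ρ) α
  Sat ρ (∀ᶠ α)    = (c : M) → Sat (c ∷ ρ) α

  -- θ(a,Γ)
  solutions : Formula 2 → M → Pred M ℓ
  solutions θ a b = Sat (a ∷ b ∷ []) θ

  TotallyPreserved : Pred M ℓ → Formula 2 → Set ℓ
  TotallyPreserved P θ = ∀ a → a ∈ P → solutions θ a ⊆ P

  -- EqClosure R a b says that a and b are joined by a path of edges
  -- R(x,y) ∨ R(y,x), so components are the sets of vertices joined to a vertex.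
  IsConnectedComponent : Pred M ℓ → Set ℓ
  IsConnectedComponent C = ∃ λ (a : M) → C ≐ EqClosure R a

  IsUnionOfConnectedComponents : Pred M ℓ → Set (Level.suc ℓ)
  IsUnionOfConnectedComponents P =
    Σ (Set ℓ) λ I → Σ (I → Pred M ℓ) λ C →
      (∀ i → IsConnectedComponent (C i)) × P ≐ ⋃ I C

{-# OPTIONS --safe #-}
module Submission where

open import Defs
open import Data.Fin using (Fin; zero; suc)
open import Data.Nat using (ℕ; zero; suc; _≥_; z≤n; s≤s)
open import Data.Product using (Σ; _×_; _,_; proj₁; proj₂)
open import Data.Sum using (inj₁; inj₂)
open import Data.Vec using (Vec; _∷_; lookup)
open import Function.Bundles using (_⇔_; mk⇔)
open import Level using (Level)
open import Relation.Binary.Construct.Closure.Equivalence using (EqClosure; symmetric; transitive)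
open import Relation.Binary.Construct.Closure.ReflexiveTransitive using (ε; _◅_)
open import Relation.Binary.Construct.Closure.Symmetric using (fwd; bwd)
open import Relation.Binary.PropositionalEquality using (refl)
open import Relation.Unary using (Pred; Satisfiable; _∈_)

-- Conditions (1) and (2) each amount to P being closed under the equivalence
-- relation generated by R: a single edge is a path of length at most n, as
-- n ≥ 1, and a path in either direction joins vertices of one component.  A
-- set closed under this relation is the union of the components of its members.

module _ {ℓ : Level} (Γ : Graph ℓ) where
  open Graph Γ

  -- Arbitrary `ρ`, `x` and `y` are what the induction on `n` needs: each quantifier puts the next
  -- vertex `c` in front of the assignment, so the remaining path starts at `zero` and its end is
  -- renamed to `suc y`, with the same value.
  φ⇒connected : ∀ {k} (ρ : Vec M k) n (x y : Fin k) →
    Sat Γ ρ (φ n x y) → EqClosure R (lookup ρ x) (lookup ρ y)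
  φ⇒connected ρ zero    x y eq rewrite eq = ε
  φ⇒connected ρ (suc n) x y (c , r , p) =
    fwd r ◅ φ⇒connected (c ∷ ρ) n zero (suc y) p

  ψ⇒connected : ∀ {k} (ρ : Vec M k) n (x y : Fin k) →
    Sat Γ ρ (ψ n x y) → EqClosure R (lookup ρ x) (lookup ρ y)
  ψ⇒connected ρ zero    x y p        = φ⇒connected ρ zero x y p
  ψ⇒connected ρ (suc n) x y (inj₁ p) = ψ⇒connected ρ n x y p
  ψ⇒connected ρ (suc n) x y (inj₂ p) = φ⇒connected ρ (suc n) x y p

  -- The disjunctions in `ψ` nest to the left, so the recursion descends through the left disjuncts
  -- until it reaches `ψ 1`.
  edge⇒ψ : ∀ {k} (ρ : Vec M k) {n} → n ≥ 1 → (x y : Fin k) →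
    R (lookup ρ x) (lookup ρ y) → Sat Γ ρ (ψ n x y)
  -- The right disjunct is `φ 1`: the vertex after the edge is already the end of the path, so the
  -- final equation holds by `refl`.
  edge⇒ψ ρ {suc zero}    _ x y r = inj₂ (lookup ρ y , r , refl)
  edge⇒ψ ρ {suc (suc n)} _ x y r = inj₁ (edge⇒ψ ρ {suc n} (s≤s z≤n) x y r)

  module _ (P : Pred M ℓ) where

    ClosedUnderConnection : Set ℓ
    ClosedUnderConnection = ∀ {a b} → EqClosure R a b → a ∈ P → b ∈ P

    edge-preserved⇒closed :
      TotallyPreserved Γ P (Rᶠ 𝐱 𝐲 ∨ᶠ Rᶠ 𝐲 𝐱) → ClosedUnderConnection
    edge-preserved⇒closed pres ε           a∈P = a∈P
    edge-preserved⇒closed pres (fwd r ◅ p) a∈P =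
      edge-preserved⇒closed pres p (pres _ a∈P (inj₁ r))
    edge-preserved⇒closed pres (bwd r ◅ p) a∈P =
      edge-preserved⇒closed pres p (pres _ a∈P (inj₂ r))

    closed⇒edge-preserved :
      ClosedUnderConnection → TotallyPreserved Γ P (Rᶠ 𝐱 𝐲 ∨ᶠ Rᶠ 𝐲 𝐱)
    closed⇒edge-preserved closed a a∈P (inj₁ r) = closed (fwd r ◅ ε) a∈P
    closed⇒edge-preserved closed a a∈P (inj₂ r) = closed (bwd r ◅ ε) a∈P

    closed⇒ψ-preserved :
      ClosedUnderConnection → ∀ n → TotallyPreserved Γ P (ψ n 𝐱 𝐲 ∨ᶠ ψ n 𝐲 𝐱)
    closed⇒ψ-preserved closed n a a∈P (inj₁ p) =
      closed (ψ⇒connected _ n 𝐱 𝐲 p) a∈P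
    -- Here the path runs from the new vertex to `a`, so the connection has to be reversed.
    closed⇒ψ-preserved closed n a a∈P (inj₂ p) =
      closed (symmetric R (ψ⇒connected _ n 𝐲 𝐱 p)) a∈P

    ψ-preserved⇒edge-preserved : ∀ {n} → n ≥ 1 →
      TotallyPreserved Γ P (ψ n 𝐱 𝐲 ∨ᶠ ψ n 𝐲 𝐱) →
      TotallyPreserved Γ P (Rᶠ 𝐱 𝐲 ∨ᶠ Rᶠ 𝐲 𝐱)
    ψ-preserved⇒edge-preserved n≥1 pres a a∈P (inj₁ r) =
      pres a a∈P (inj₁ (edge⇒ψ _ n≥1 𝐱 𝐲 r))
    ψ-preserved⇒edge-preserved n≥1 pres a a∈P (inj₂ r) =
      pres a a∈P (inj₂ (edge⇒ψ _ n≥1 𝐲 𝐱 r))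

    -- The family is indexed by the members of `P`, so a component may occur many times; this avoids
    -- choosing one representative for each.
    closed⇒union : ClosedUnderConnection → IsUnionOfConnectedComponents Γ P
    closed⇒union closed =
      Σ M P , (λ i → EqClosure R (proj₁ i)) ,
      (λ i → proj₁ i , (λ p → p) , (λ p → p)) ,
      (λ {a} a∈P → (a , a∈P) , ε) ,
      (λ ((_ , a∈P) , p) → closed p a∈P)

    union⇒closed : IsUnionOfConnectedComponents Γ P → ClosedUnderConnection
    union⇒closed (I , C , component , P⊆⋃ , ⋃⊆P) b~c b∈P =
      let i , b∈Cᵢ            = P⊆⋃ b∈P
          a , Cᵢ⊆[a] , [a]⊆Cᵢ = component i
      -- The base point `a` of the component containing `b` is connected to `c` through `b`, so `c`
      -- lies in the same member of the family.
      in ⋃⊆P (i , [a]⊆Cᵢ (transitive R (Cᵢ⊆[a] b∈Cᵢ) b~c))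

theorem8p2 : ∀ {ℓ : Level} (Γ : Graph ℓ) (P : Pred (Graph.M Γ) ℓ) → Satisfiable P →
    (TotallyPreserved Γ P (Rᶠ 𝐱 𝐲 ∨ᶠ Rᶠ 𝐲 𝐱)
    ⇔ (Σ ℕ λ n → n ≥ 1 × TotallyPreserved Γ P (ψ n 𝐱 𝐲 ∨ᶠ ψ n 𝐲 𝐱)))
    × (TotallyPreserved Γ P (Rᶠ 𝐱 𝐲 ∨ᶠ Rᶠ 𝐲 𝐱)
    ⇔ ((n : ℕ) → n ≥ 1 → TotallyPreserved Γ P (ψ n 𝐱 𝐲 ∨ᶠ ψ n 𝐲 𝐱)))
    × (TotallyPreserved Γ P (Rᶠ 𝐱 𝐲 ∨ᶠ Rᶠ 𝐲 𝐱)
    ⇔ IsUnionOfConnectedComponents Γ P)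
theorem8p2 Γ P _ =
  mk⇔ (λ pres → 1 , s≤s z≤n , ψ-pres pres 1)
      (λ (n , n≥1 , pres) → ψ-preserved⇒edge-preserved Γ P n≥1 pres) ,
  mk⇔ (λ pres n _ → ψ-pres pres n)
      -- The instance `n = 1` is enough to recover preservation along edges.
      (λ pres → ψ-preserved⇒edge-preserved Γ P {1} (s≤s z≤n) (pres 1 (s≤s z≤n))) ,
  mk⇔ (λ pres → closed⇒union Γ P (edge-preserved⇒closed Γ P pres))
      (λ union → closed⇒edge-preserved Γ P (union⇒closed Γ P union))
  where
  ψ-pres : TotallyPreserved Γ P (Rᶠ 𝐱 𝐲 ∨ᶠ Rᶠ 𝐲 𝐱) →
    ∀ n → TotallyPreserved Γ P (ψ n 𝐱 𝐲 ∨ᶠ ψ n 𝐲 𝐱)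
  ψ-pres pres = closed⇒ψ-preserved Γ P (edge-preserved⇒closed Γ P pres)
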